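{- Let $n_1,n_2,n_3$ be integers with $3\le n_1,n_2\le n_3$. If $3\max(n_1,n_2)\le 2n_3\le n_1n_2$, then for $G=K_{n_1+1}\times K_{n_2+1}\times K_{n_3+1}$ the metric dimension $\dim(G)$, the location-domination number $\gamma^L(G)$, and the location-total-domination number $\gamma^L_t(G)$ are all equal to $2(n_3+1)-1$.
   Context: $K_{m_1}\times K_{m_2}\times K_{m_3}$: vertices are triples $(x_1,x_2,x_3)$, $1\le x_i\le m_i$, adjacent iff they differ in every coordinate. A set $W$ of vertices is resolving if for every two distinct vertices $x,y\notin W$ some $w\in W$ has $d(x,w)\ne d(y,w)$; $\dim(G)$ is the minimum size of a resolving set. A dominating set is a vertex set $D$ such that every vertex is in $D$ or adjacent to a vertex of $D$; a total-dominating set is one such that every vertex is adjacent to a vertex of $D$. A locating-dominating (resp. locating-total-dominating) set is a resolving set that is also dominating (resp. total-dominating); $\gamma^L(G)$ (resp. $\gamma^L_t(G)$) is the minimum size of such a set. -}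

module Defs where

open import Data.Nat.Base using (ℕ; zero; suc; _≤_)
open import Data.Fin.Base using (Fin)
open import Data.List.Base using (List; length)
open import Data.List.Membership.Propositional using (_∈_; _∉_)
open import Data.List.Relation.Unary.Unique.Propositional using (Unique)
open import Data.Product.Base using (∃-syntax; _×_; _,_; proj₁; proj₂)
open import Data.Sum.Base using (_⊎_)
open import Relation.Binary.Definitions using (Symmetric; Irreflexive)
open import Relation.Binary.PropositionalEquality.Core using (_≡_; _≢_; refl; ≢-sym)
open import Relation.Nullary.Negation.Core using (¬_)

record Graph : Set₁ where
  field
    Vertex  : Set
    Adj     : Vertex → Vertex → Set
    symm    : Symmetric Adj
    irrefl  : Irreflexive _≡_ Adj

open Graph public using (Vertex)

K : ℕ → Graph
K m = record
  { Vertex = Fin m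
  ; Adj    = _≢_
  ; symm   = ≢-sym
  ; irrefl = λ x≡y x≢y → x≢y x≡y
  }

-- Direct (tensor) product: adjacency in both coordinates.  Associating to the
-- right, K m₁ ⊗ K m₂ ⊗ K m₃ has triples as vertices, adjacent exactly when they
-- differ in every coordinate.
infixr 7 _⊗_

_⊗_ : Graph → Graph → Graph
G ⊗ H = record
  { Vertex = G.Vertex × H.Vertex
  ; Adj    = λ x y → G.Adj (proj₁ x) (proj₁ y) × H.Adj (proj₂ x) (proj₂ y)
  ; symm   = λ (g , h) → G.symm g , H.symm h
  ; irrefl = λ { refl (g , _) → G.irrefl refl g }
  }
  where
  module G = Graph G
  module H = Graph H

module _ (G : Graph) where
  open Graph G using (Adj)

  data Walk : Vertex G → Vertex G → ℕ → Set where
    []  : ∀ {x} → Walk x x zero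
    _∷_ : ∀ {x y z n} → Adj x y → Walk y z n → Walk x z (suc n)

  -- d(x,y) = n as a relation; it holds for no n when x and y are in different
  -- components, i.e. when d(x,y) = ∞.
  Dist : Vertex G → Vertex G → ℕ → Set
  Dist x y n = Walk x y n × (∀ k → Walk x y k → n ≤ k)

  -- d(x,w) ≠ d(y,w) in ℕ ∪ {∞}: some n is one of the two distances but not the other.
  Separates : Vertex G → Vertex G → Vertex G → Set
  Separates w x y =
    ∃[ n ] ((Dist x w n × ¬ Dist y w n) ⊎ (¬ Dist x w n × Dist y w n))

  -- Finite vertex sets are lists; duplicates are excluded in MinSize, where
  -- cardinality matters.
  Resolving : List (Vertex G) → Set
  Resolving W = ∀ x y → x ∉ W → y ∉ W → x ≢ y → ∃[ w ] (w ∈ W × Separates w x y)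

  Dominating : List (Vertex G) → Set
  Dominating D = ∀ x → x ∈ D ⊎ ∃[ w ] (w ∈ D × Adj x w)

  TotalDominating : List (Vertex G) → Set
  TotalDominating D = ∀ x → ∃[ w ] (w ∈ D × Adj x w)

  LocatingDominating : List (Vertex G) → Set
  LocatingDominating W = Resolving W × Dominating W

  LocatingTotalDominating : List (Vertex G) → Set
  LocatingTotalDominating W = Resolving W × TotalDominating W

  MinSize : (List (Vertex G) → Set) → ℕ → Set
  MinSize P k =
      (∃[ W ] (Unique W × P W × length W ≡ k))
    × (∀ W → Unique W → P W → k ≤ length W)

  -- "The invariant equals k", as relations: dim(G) = k, γᴸ(G) = k, γᴸₜ(G) = k.
  MetricDimension : ℕ → Set
  MetricDimension = MinSize Resolving

  LocationDominationNumber : ℕ → Set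
  LocationDominationNumber = MinSize LocatingDominating

  LocationTotalDominationNumber : ℕ → Set
  LocationTotalDominationNumber = MinSize LocatingTotalDominating

{-# OPTIONS --safe #-}
-- A vertex w is at distance 1 from x exactly when it shares no coordinate with x, and
-- all other distances between distinct vertices are 2; so W resolves as soon as
-- N(x) = {w ∈ W : w shares a coordinate with x} determines x.
--
-- Lower bound: if at most two elements of W have last coordinate z or z′, then some
-- (p , q) shares exactly one coordinate with each of them, and (p , q , z), (p , q , z′)
-- are not resolved.  So any two fibres of the last coordinate have together at least 3
-- elements, whence |W| ≥ 2 n₃ + 1.
--
-- Upper bound: take (0 , 0 , 0) together with two cells (p , q , k), (p′ , q′ , k),
-- p ≠ p′, q ≠ q′, for each k ∈ {1..n₃}, such that the 2 n₃ cells in the n₁ × n₂ grid are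
-- distinct, the 2 n₃ opposite corners (p , q′), (p′ , q) are distinct, and every row
-- and every column contains at least 3 cells.  By pigeonhole N(x) determines the first two
-- coordinates of x; the corners being distinct, it determines the last one as well.
-- Such designs are built from a few small ones by transposing, adding two rows,
-- and adding a 4 × 4 diagonal block when n₃ is within 2 of its minimum.
module Submission where

open import Defs
open import Data.Nat.Base using (ℕ; _+_; _*_; _∸_; _≤_; _⊔_)
open import Data.Product.Base using (_×_)
open import Data.Bool.Base using (Bool; true; false; not; _xor_)
open import Data.Empty using (⊥; ⊥-elim)
open import Data.Fin.Base using (Fin; zero; suc; toℕ; fromℕ; fromℕ<; inject₁; inject≤; punchIn)
open import Data.Fin.Patterns using (0F; 1F; 2F; 3F; 4F; 5F; 6F)
open import Data.Fin.Properties using (_≟_; all?; any?; toℕ-injective; toℕ-fromℕ<; toℕ-inject≤; toℕ-inject₁; inject≤-injective; inject₁-injective; fromℕ≢inject₁; +↔⊎; 2↔Bool; punchInᵢ≢i; suc-injective)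
open import Data.List.Base as List using (List; []; _∷_; _++_; length; filter; map; allFin; cartesianProductWith)
open import Data.List.Membership.Propositional using (_∈_; _∉_; find; lose)
open import Data.List.Membership.Propositional.Properties using (∈-filter⁺; ∈-map⁺; ∈-++⁺ˡ; ∈-++⁺ʳ; ∈-cartesianProductWith⁺; ∈-cartesianProductWith⁻; ∈-allFin)
open import Data.List.Properties using (length-map; length-++; length-tabulate; filter-accept; filter-reject)
open import Data.List.Relation.Unary.All as All using (All; []; _∷_)
open import Data.List.Relation.Unary.Any as Any using (here; there)
open import Data.List.Relation.Unary.Unique.Propositional using (Unique; []; _∷_)
open import Data.List.Relation.Unary.Unique.Propositional.Properties using (cartesianProductWith⁺; allFin⁺)
open import Data.Nat.Base using (zero; suc; _<_; ⌈_/2⌉; z≤n; s≤s)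
open import Data.Nat.Induction using (Acc; acc; <-wellFounded)
open import Data.Nat.Properties hiding (_≟_; suc-injective)
open import Algebra.Properties.CommutativeMonoid.Sum +-0-commutativeMonoid using (sum; sum-remove; sum-cong-≗; sum-replicate-zero)
open import Data.Nat.Tactic.RingSolver using (solve-∀; solve)
open import Data.Product.Base using (∃-syntax; _,_; proj₁; proj₂)
open import Data.Sum.Base using (_⊎_; inj₁; inj₂)
open import Data.Sum.Function.Propositional using (_⊎-↔_)
open import Data.Sum.Properties using (inj₁-injective; inj₂-injective)
open import Data.Vec.Base using (Vec; []; _∷_; lookup)
open import Function.Base using (_∘_; id)
open import Function.Bundles using (_↔_; Inverse)
open import Function.Construct.Composition using (_↔-∘_)
open import Function.Construct.Identity using (↔-id)
open import Function.Construct.Symmetry using (↔-sym)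
open import Relation.Binary.PropositionalEquality using (_≡_; _≢_; refl; sym; trans; cong; cong₂; subst; subst₂; ≢-sym; module ≡-Reasoning)
open import Relation.Nullary.Decidable using (Dec; yes; no; _×-dec_; _⊎-dec_; _→-dec_; ¬?; map′; from-yes)
open import Relation.Nullary.Negation using (¬_; contradiction)
open import Relation.Unary using (Decidable)

-- The lower bound

Σ-bump : ∀ {n} (f g : Fin n → ℕ) i → g i ≡ suc (f i) → (∀ j → i ≢ j → g j ≡ f j) →
  sum g ≡ suc (sum f)
Σ-bump {suc n} f g i gᵢ g≗f = begin
  sum g                            ≡⟨ sum-remove {i = i} g ⟩
  g i + sum (g ∘ punchIn i)        ≡⟨ cong₂ _+_ gᵢ (sum-cong-≗ (λ j → g≗f _ (≢-sym (punchInᵢ≢i i j)))) ⟩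
  suc (f i + sum (f ∘ punchIn i))  ≡⟨ cong suc (sum-remove {i = i} f) ⟨
  suc (sum f)                      ∎
  where open ≡-Reasoning

Σ-lower : ∀ {n} m (f : Fin n → ℕ) → (∀ i → m ≤ f i) → n * m ≤ sum f
Σ-lower {zero}  m f m≤f = z≤n
Σ-lower {suc n} m f m≤f = +-mono-≤ (m≤f zero) (Σ-lower m (f ∘ suc) (m≤f ∘ suc))

-- If every value is at least 2, the sum is at least 2(n + 2). Otherwise some value is 0 or 1, and
-- all others are then at least 3 or at least 2 respectively.
Σ-pairwise≥3 : ∀ {n} (f : Fin (2 + n) → ℕ) → (∀ i j → i ≢ j → 3 ≤ f i + f j) →
  suc (2 * suc n) ≤ sum f
Σ-pairwise≥3 {n} f f≥3 with any? (λ i → f i ≤? 1)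
... | no all≥2 =
  ≤-trans (≤-reflexive (cong suc (*-comm 2 (suc n))))
    (≤-trans (n≤1+n _) (Σ-lower 2 f λ i → ≰⇒> (λ fᵢ≤1 → all≥2 (i , fᵢ≤1))))
... | yes (i , fᵢ≤1) rewrite sum-remove {i = i} f = split (f i) refl fᵢ≤1
  where
  others : ∀ m l → f i ≡ m → m + l ≡ 3 → ∀ j → l ≤ f (punchIn i j)
  others m l fᵢ≡m m+l≡3 j = +-cancelˡ-≤ m l _
    (subst₂ _≤_ (sym m+l≡3) (cong (_+ f (punchIn i j)) fᵢ≡m) (f≥3 i _ (≢-sym (punchInᵢ≢i i j))))
  split : ∀ m → f i ≡ m → m ≤ 1 → suc (2 * suc n) ≤ f i + sum (f ∘ punchIn i)
  split 0 fᵢ≡0 _ = ≤-trans (≤-trans 1+2n≤3n (Σ-lower 3 _ (others 0 3 fᵢ≡0 refl))) (m≤n+m _ (f i))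
    where
    1+2n≤3n : suc (2 * suc n) ≤ suc n * 3
    1+2n≤3n = subst (suc (2 * suc n) ≤_) (*-comm 3 (suc n)) (s≤s (m≤n+m (2 * suc n) n))
  split 1 fᵢ≡1 _ = ≤-trans (s≤s (≤-trans (≤-reflexive (*-comm 2 (suc n))) (Σ-lower 2 _ (others 1 2 fᵢ≡1 refl))))
    (≤-reflexive (cong (_+ sum (f ∘ punchIn i)) (sym fᵢ≡1)))
  split (suc (suc _)) _ (s≤s ())

module _ {A : Set} {n} (φ : A → Fin n) where

  fibre : List A → Fin n → List A
  fibre xs z = filter (λ x → φ x ≟ z) xs

  Σ-fibres : ∀ xs → sum (length ∘ fibre xs) ≡ length xs
  Σ-fibres []       = sum-replicate-zero n
  Σ-fibres (x ∷ xs) = trans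
    (Σ-bump (length ∘ fibre xs) (length ∘ fibre (x ∷ xs)) (φ x)
      (cong length (filter-accept (λ y → φ y ≟ φ x) refl))
      (λ z φx≢z → cong length (filter-reject (λ y → φ y ≟ z) φx≢z)))
    (cong suc (Σ-fibres xs))

avoid₂ : ∀ {n} (p q : Fin (3 + n)) → ∃[ r ] p ≢ r × q ≢ r
avoid₂ 0F            0F            = 1F , (λ ()) , (λ ())
avoid₂ 0F            1F            = 2F , (λ ()) , (λ ())
avoid₂ 0F            (suc (suc q)) = 1F , (λ ()) , (λ ())
avoid₂ 1F            0F            = 2F , (λ ()) , (λ ())
avoid₂ (suc (suc p)) 0F            = 1F , (λ ()) , (λ ())
avoid₂ (suc p)       (suc q)       = 0F , (λ ()) , (λ ())

SharesOne : {A B : Set} → A → B → A × B → Set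
SharesOne p q (u , v) = (p ≡ u × q ≢ v) ⊎ (p ≢ u × q ≡ v)

-- Two points differing in both coordinates are crossed to `(u , v′)`. If they agree in a
-- coordinate, it is kept and the other is chosen to avoid both, which takes three values.
sharesOne-with-two : ∀ {m n} (us : List (Fin (3 + m) × Fin (3 + n))) → length us ≤ 2 →
  ∃[ p ] ∃[ q ] All (SharesOne p q) us
sharesOne-with-two [] _ = 0F , 0F , []
sharesOne-with-two ((u , v) ∷ []) _ with q , v≢q , _ ← avoid₂ v v =
  u , q , inj₁ (refl , ≢-sym v≢q) ∷ []
sharesOne-with-two ((u , v) ∷ (u′ , v′) ∷ []) _ with u ≟ u′ | v ≟ v′
... | yes refl | _ with q , v≢q , v′≢q ← avoid₂ v v′ =
  u , q , inj₁ (refl , ≢-sym v≢q) ∷ inj₁ (refl , ≢-sym v′≢q) ∷ []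
... | no u≢u′ | yes refl with p , u≢p , u′≢p ← avoid₂ u u′ =
  p , v , inj₂ (≢-sym u≢p , refl) ∷ inj₂ (≢-sym u′≢p , refl) ∷ []
... | no u≢u′ | no v≢v′ = u , v′ , inj₁ (refl , ≢-sym v≢v′) ∷ inj₂ (u≢u′ , refl) ∷ []
sharesOne-with-two (_ ∷ _ ∷ _ ∷ _) (s≤s (s≤s ()))

-- Distances and separation when any two vertices have a common neighbour

module _ (G : Graph) where
  open Graph G using (Adj; irrefl)

  adjacent⇒Dist-1 : ∀ {x w} → Adj x w → Dist G x w 1
  adjacent⇒Dist-1 xw = xw ∷ [] , λ
    { zero    []  → contradiction xw (irrefl refl)
    ; (suc _) _   → s≤s z≤n }

  Dist-1⇒adjacent : ∀ {x w} → Dist G x w 1 → Adj x w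
  Dist-1⇒adjacent (xw ∷ [] , _) = xw

  adjacency-separates : ∀ {w x y} → (Adj x w × ¬ Adj y w) ⊎ (¬ Adj x w × Adj y w) → Separates G w x y
  adjacency-separates (inj₁ (xw , ¬yw)) = 1 , inj₁ (adjacent⇒Dist-1 xw , ¬yw ∘ Dist-1⇒adjacent)
  adjacency-separates (inj₂ (¬xw , yw)) = 1 , inj₂ (¬xw ∘ Dist-1⇒adjacent , adjacent⇒Dist-1 yw)

  module _ (commonNeighbour : ∀ x y → ∃[ z ] Adj x z × Adj z y) where

    -- Common neighbours bound all distances by 2, so from a vertex other than `w` the distance to
    -- `w` is decided by adjacency alone.
    Dist-transfer : ∀ {x y w n} → x ≢ w → y ≢ w → (Adj x w → Adj y w) → (Adj y w → Adj x w) →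
      Dist G x w n → Dist G y w n
    Dist-transfer {n = 0} x≢w _ _ _ ([] , _) = contradiction refl x≢w
    Dist-transfer {n = 1} _ _ x⇒y _ d = adjacent⇒Dist-1 (x⇒y (Dist-1⇒adjacent d))
    Dist-transfer {x} {y} {w} {suc (suc n)} _ y≢w _ y⇒x (_ , shortest)
      with u , xu , uw ← commonNeighbour x w
      -- The walk through `u` forces the distance from `x` to `w` to be exactly 2.
      with s≤s (s≤s z≤n) ← shortest 2 (xu ∷ uw ∷ [])
      with v , yv , vw ← commonNeighbour y w
      = yv ∷ vw ∷ [] , λ
        { 0 [] → contradiction refl y≢w
        ; 1 (yw ∷ []) → shortest 1 (y⇒x yw ∷ [])
        ; (suc (suc _)) _ → s≤s (s≤s z≤n) }

    ¬separates : ∀ {x y w} → x ≢ w → y ≢ w → (Adj x w → Adj y w) → (Adj y w → Adj x w) →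
      ¬ Separates G w x y
    ¬separates x≢w y≢w x⇒y y⇒x (n , inj₁ (dx , ¬dy)) = ¬dy (Dist-transfer x≢w y≢w x⇒y y⇒x dx)
    ¬separates x≢w y≢w x⇒y y⇒x (n , inj₂ (¬dx , dy)) = ¬dx (Dist-transfer y≢w x≢w y⇒x x⇒y dy)

module _ {a b c : ℕ} where

  private
    G = K (3 + a) ⊗ K (3 + b) ⊗ K (3 + c)

  commonNeighbour : ∀ x y → ∃[ z ] Graph.Adj G x z × Graph.Adj G z y
  commonNeighbour (x₁ , x₂ , x₃) (y₁ , y₂ , y₃)
    with z₁ , x₁≢z₁ , y₁≢z₁ ← avoid₂ x₁ y₁
       | z₂ , x₂≢z₂ , y₂≢z₂ ← avoid₂ x₂ y₂
       | z₃ , x₃≢z₃ , y₃≢z₃ ← avoid₂ x₃ y₃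
    = (z₁ , z₂ , z₃) , (x₁≢z₁ , x₂≢z₂ , x₃≢z₃) , (≢-sym y₁≢z₁ , ≢-sym y₂≢z₂ , ≢-sym y₃≢z₃)

  third : Vertex G → Fin (3 + c)
  third (_ , _ , z) = z

  firstTwo : Vertex G → Fin (3 + a) × Fin (3 + b)
  firstTwo (u , v , _) = u , v

  -- If the fibres over z and z′ have at most two elements, some (p , q) shares
  -- exactly one coordinate with each of them, so (p , q , z) and (p , q , z′)
  -- lie outside W and have the same neighbours in W.
  fibres≥3 : ∀ W → Resolving G W → ∀ z z′ → z ≢ z′ →
    3 ≤ length (fibre third W z) + length (fibre third W z′)
  fibres≥3 W resolving z z′ z≢z′
    with 3 ≤? length (fibre third W z) + length (fibre third W z′)
  ... | yes ≥3 = ≥3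
  ... | no  ≱3
    with p , q , shares ← sharesOne-with-two
           (map firstTwo (fibre third W z ++ fibre third W z′))
           (subst (_≤ 2) (sym (trans (length-map firstTwo (fibre third W z ++ fibre third W z′))
             (length-++ (fibre third W z) {fibre third W z′}))) (≤-pred (≰⇒> ≱3)))
    = contradiction
        (resolving (p , q , z) (p , q , z′) (outside (inj₁ refl)) (outside (inj₂ refl)) (z≢z′ ∘ cong third))
        λ (w , w∈W , sep) → ¬separates G commonNeighbour
          (λ { refl → outside (inj₁ refl) w∈W }) (λ { refl → outside (inj₂ refl) w∈W })
          -- An element of `W` adjacent to one of the two vertices cannot have the last coordinate
          -- of the other: it would then share `p` or `q`.
          (λ (p≢ , q≢ , _) → p≢ , q≢ , λ z′≡ → missed (shared w∈W (inj₂ (sym z′≡))) p≢ q≢)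
          (λ (p≢ , q≢ , _) → p≢ , q≢ , λ z≡ → missed (shared w∈W (inj₁ (sym z≡))) p≢ q≢)
          sep
    where
    shared : ∀ {u v t} → (u , v , t) ∈ W → t ≡ z ⊎ t ≡ z′ → SharesOne p q (u , v)
    shared w∈W (inj₁ t≡z)  = All.lookup shares (∈-map⁺ _ (∈-++⁺ˡ (∈-filter⁺ (λ x → third x ≟ z) w∈W t≡z)))
    shared w∈W (inj₂ t≡z′) = All.lookup shares (∈-map⁺ _
      (∈-++⁺ʳ (fibre third W z) (∈-filter⁺ (λ x → third x ≟ z′) w∈W t≡z′)))
    missed : ∀ {u v} → SharesOne p q (u , v) → p ≢ u → q ≢ v → _
    missed (inj₁ (p≡u , _)) p≢u _ = p≢u p≡u
    missed (inj₂ (_ , q≡v)) _ q≢v = q≢v q≡v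
    outside : ∀ {t} → t ≡ z ⊎ t ≡ z′ → (p , q , t) ∉ W
    outside t∈ w∈W with shared w∈W t∈
    ... | inj₁ (_ , q≢q) = q≢q refl
    ... | inj₂ (p≢p , _) = p≢p refl

  resolving-size : ∀ W → Resolving G W → suc (2 * (2 + c)) ≤ length W
  resolving-size W resolving = subst (suc (2 * (2 + c)) ≤_) (Σ-fibres third W)
    (Σ-pairwise≥3 (length ∘ fibre third W) (fibres≥3 W resolving))

-- Designs

Thrice : {I : Set} → (I → Set) → Set
Thrice P = ∃[ k₁ ] P k₁ × (∃[ k₂ ] P k₂ × k₁ ≢ k₂ × (∃[ k₃ ] P k₃ × k₁ ≢ k₃ × k₂ ≢ k₃))

-- The map may depend on the proof of `P k`; in `tableDesign` that proof carries the bound placing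
-- `k` in the prefix.
Thrice-map : {I J : Set} {P : I → Set} {Q : J → Set} (f : ∀ k → P k → J) →
  (∀ {k l} p q → f k p ≡ f l q → k ≡ l) → (∀ k p → Q (f k p)) → Thrice P → Thrice Q
Thrice-map f f-inj f-Q (k₁ , p₁ , k₂ , p₂ , k₁≢k₂ , k₃ , p₃ , k₁≢k₃ , k₂≢k₃) =
  f k₁ p₁ , f-Q k₁ p₁ ,
  f k₂ p₂ , f-Q k₂ p₂ , k₁≢k₂ ∘ f-inj p₁ p₂ ,
  f k₃ p₃ , f-Q k₃ p₃ , k₁≢k₃ ∘ f-inj p₁ p₃ , k₂≢k₃ ∘ f-inj p₂ p₃

Thrice? : ∀ {n} {P : Fin n → Set} → Decidable P → Dec (Thrice P)
Thrice? P? = any? λ k₁ → P? k₁ ×-dec any? λ k₂ → P? k₂ ×-dec ¬? (k₁ ≟ k₂) ×-dec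
  any? λ k₃ → P? k₃ ×-dec ¬? (k₁ ≟ k₃) ×-dec ¬? (k₂ ≟ k₃)

Meets : {A I : Set} → (I → Bool → A) → A → I → Set
Meets f x k = ∃[ ε ] f k ε ≡ x

-- Each k ∈ I names a pair of cells (row k ε , col k ε) of the grid A × B, on
-- distinct rows and columns.  The other two corners of the rectangle they span
-- are (row k ε , col k (not ε)).  At δ = false, pair-inj says that no cell is
-- used by two pairs; at δ = true, that no cell is a corner of two pairs.
record Pairing (A B I : Set) : Set where
  field
    row      : I → Bool → A
    col      : I → Bool → B
    row-≢    : ∀ k → row k false ≢ row k true
    col-≢    : ∀ k → col k false ≢ col k true
    pair-inj : ∀ δ {k l} ε η → row k ε ≡ row l η → col k (δ xor ε) ≡ col l (δ xor η) → k ≡ l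

-- The two cells of a pair lie on distinct lines, so three pairs meeting a line amount to three
-- cells on it.
record Design (A B I : Set) : Set where
  field
    pairing : Pairing A B I
  open Pairing pairing public
  field
    row-thrice : ∀ i → Thrice (Meets row i)
    col-thrice : ∀ j → Thrice (Meets col j)

-- Transposing, relabelling and enlarging designs

transpose : ∀ {A B I} → Design A B I → Design B A I
transpose D = record
  { pairing = record
    { row = col ; col = row ; row-≢ = col-≢ ; col-≢ = row-≢
    ; pair-inj = λ
      { false ε η c r → pair-inj false ε η r c
      -- Corners are indexed by their row, so the corner in column `col k ε` has index `not ε`; the
      -- column equation then carries a double negation.
      ; true  ε η c r → pair-inj true (not ε) (not η) r (not-not c) }
    }
  ; row-thrice = col-thrice
  ; col-thrice = row-thrice
  }
  where
  open Design D
  not-not : ∀ {k l ε η} → col k ε ≡ col l η → col k (not (not ε)) ≡ col l (not (not η))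
  not-not {ε = false} {false} e = e
  not-not {ε = false} {true}  e = e
  not-not {ε = true}  {false} e = e
  not-not {ε = true}  {true}  e = e

relabel : ∀ {A A′ B B′ I I′} → A ↔ A′ → B ↔ B′ → I ↔ I′ → Design A B I → Design A′ B′ I′
relabel {A} {A′} {B} {B′} {I} {I′} f g h D = record
  { pairing = record
    { row      = λ k ε → f.to (row (h.from k) ε)
    ; col      = λ k ε → g.to (col (h.from k) ε)
    ; row-≢    = λ k → row-≢ (h.from k) ∘ to-inj f
    ; col-≢    = λ k → col-≢ (h.from k) ∘ to-inj g
    ; pair-inj = λ δ ε η r c → to-inj (↔-sym h) (pair-inj δ ε η (to-inj f r) (to-inj g c))
    }
  ; row-thrice = λ i → thrice f row i (row-thrice (f.from i))
  ; col-thrice = λ j → thrice g col j (col-thrice (g.from j))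
  }
  where
  open Design D
  module f = Inverse f
  module g = Inverse g
  module h = Inverse h
  to-inj : ∀ {X Y : Set} (e : X ↔ Y) {x y} → Inverse.to e x ≡ Inverse.to e y → x ≡ y
  to-inj e {x} {y} eq = trans (sym (Inverse.strictlyInverseʳ e x))
    (trans (cong (Inverse.from e) eq) (Inverse.strictlyInverseʳ e y))
  thrice : ∀ {X Y : Set} (e : X ↔ Y) (line : I → Bool → X) y →
    Thrice (Meets line (Inverse.from e y)) →
    Thrice (Meets (λ k ε → Inverse.to e (line (h.from k) ε)) y)
  thrice e line y = Thrice-map (λ k _ → h.to k) (λ _ _ → to-inj h) λ k (ε , eq) →
    ε , trans (cong (λ l → Inverse.to e (line l ε)) (h.strictlyInverseʳ k))
          (trans (cong (Inverse.to e) eq) (Inverse.strictlyInverseˡ e y))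

inl : {I J : Set} {P : I → Set} {Q : I ⊎ J → Set} →
  (∀ k → P k → Q (inj₁ k)) → Thrice P → Thrice Q
inl = Thrice-map (λ k _ → inj₁ k) (λ _ _ → inj₁-injective)

inr : {I J : Set} {P : J → Set} {Q : I ⊎ J → Set} →
  (∀ k → P k → Q (inj₂ k)) → Thrice P → Thrice Q
inr = Thrice-map (λ k _ → inj₂ k) (λ _ _ → inj₂-injective)

-- Cells and corners of each summand stay inside its own diagonal block, so pairs from different
-- summands cannot collide.
blockSum : ∀ {A A′ B B′ I I′} → Design A B I → Design A′ B′ I′ →
  Design (A ⊎ A′) (B ⊎ B′) (I ⊎ I′)
blockSum {A} {A′} {B} {B′} {I} {I′} D E = record
  { pairing = record
    { row      = row
    ; col      = col
    ; row-≢    = λ { (inj₁ k) → D.row-≢ k ∘ inj₁-injective ; (inj₂ k) → E.row-≢ k ∘ inj₂-injective }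
    ; col-≢    = λ { (inj₁ k) → D.col-≢ k ∘ inj₁-injective ; (inj₂ k) → E.col-≢ k ∘ inj₂-injective }
    ; pair-inj = λ
      { δ {inj₁ k} {inj₁ l} ε η r c → cong inj₁ (D.pair-inj δ ε η (inj₁-injective r) (inj₁-injective c))
      ; δ {inj₂ k} {inj₂ l} ε η r c → cong inj₂ (E.pair-inj δ ε η (inj₂-injective r) (inj₂-injective c))
      }
    }
  ; row-thrice = λ { (inj₁ i) → inl (λ _ (ε , e) → ε , cong inj₁ e) (D.row-thrice i)
                     ; (inj₂ i) → inr (λ _ (ε , e) → ε , cong inj₂ e) (E.row-thrice i) }
  ; col-thrice = λ { (inj₁ j) → inl (λ _ (ε , e) → ε , cong inj₁ e) (D.col-thrice j)
                     ; (inj₂ j) → inr (λ _ (ε , e) → ε , cong inj₂ e) (E.col-thrice j) }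
  }
  where
  module D = Design D
  module E = Design E
  row : I ⊎ I′ → Bool → A ⊎ A′
  row (inj₁ k) ε = inj₁ (D.row k ε)
  row (inj₂ k) ε = inj₂ (E.row k ε)
  col : I ⊎ I′ → Bool → B ⊎ B′
  col (inj₁ k) ε = inj₁ (D.col k ε)
  col (inj₂ k) ε = inj₂ (E.col k ε)

-- Subtraction of 1 modulo `n`.
rotate : ∀ {n} → Fin n → Fin n
rotate {suc n} zero    = fromℕ n
rotate {suc n} (suc i) = inject₁ i

rotate-injective : ∀ {n} {i j : Fin n} → rotate i ≡ rotate j → i ≡ j
rotate-injective {i = zero}  {zero}  _ = refl
rotate-injective {i = zero}  {suc j} e = contradiction e fromℕ≢inject₁
rotate-injective {i = suc i} {zero}  e = contradiction (sym e) fromℕ≢inject₁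
rotate-injective {i = suc i} {suc j} e = cong suc (inject₁-injective e)

rotate-≢ : ∀ {n} → 2 ≤ n → (i : Fin n) → i ≢ rotate i
rotate-≢ (s≤s (s≤s _)) zero    ()
rotate-≢ _             (suc i) e =
  1+n≢n (trans (cong toℕ e) (toℕ-inject₁ i))

-- New pair `k` uses column `k` in one new row and column `k` - 1 modulo `b` in the other. Both
-- column maps are injective, so within each new row cells are distinct, and so are corners. The
-- columns already have three cells from `D`.
addTwoRows : ∀ {A I b} m → 3 ≤ m → m ≤ b → Design A (Fin b) I →
  Design (Bool ⊎ A) (Fin b) (Fin m ⊎ I)
addTwoRows {A} {I} {b} m 3≤m m≤b D = record
  { pairing = record
    { row      = row
    ; col      = col
    ; row-≢    = λ { (inj₁ k) () ; (inj₂ k) → D.row-≢ k ∘ inj₂-injective }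
    ; col-≢    = λ { (inj₁ k) → rotate-≢ (≤-trans (s≤s (s≤s z≤n)) (≤-trans 3≤m m≤b)) _ ; (inj₂ k) → D.col-≢ k }
    ; pair-inj = λ
      { δ {inj₁ k} {inj₁ l} ε η refl c → cong inj₁ (col-injective (δ xor ε) c)
      ; δ {inj₂ k} {inj₂ l} ε η r c → cong inj₂ (D.pair-inj δ ε η (inj₂-injective r) c)
      }
    }
  ; row-thrice = λ { (inj₁ ε) → three ε
                   ; (inj₂ i) → inr (λ _ (ε , e) → ε , cong inj₂ e) (D.row-thrice i) }
  ; col-thrice = λ j → inr (λ _ → id) (D.col-thrice j)
  }
  where
  module D = Design D
  row : Fin m ⊎ I → Bool → Bool ⊎ A
  row (inj₁ k) ε = inj₁ ε
  row (inj₂ k) ε = inj₂ (D.row k ε)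
  col : Fin m ⊎ I → Bool → Fin b
  col (inj₁ k) false = inject≤ k m≤b
  col (inj₁ k) true  = rotate (inject≤ k m≤b)
  col (inj₂ k) ε     = D.col k ε
  col-injective : ∀ ε {k l} → col (inj₁ k) ε ≡ col (inj₁ l) ε → k ≡ l
  col-injective false e = inject≤-injective m≤b m≤b _ _ e
  col-injective true  e = inject≤-injective m≤b m≤b _ _ (rotate-injective e)
  three : ∀ ε → Thrice (Meets row (inj₁ ε))
  three ε = Thrice-map (λ k _ → inj₁ (inject≤ k 3≤m))
    (λ _ _ → inject≤-injective 3≤m 3≤m _ _ ∘ inj₁-injective) (λ _ _ → ε , refl)
    -- The trivial predicate `k ≡ k` makes the search return the three elements of `Fin 3`.
    (from-yes (Thrice? {3} {λ k → k ≡ k} (λ k → k ≟ k)))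

DesignFin : ℕ → ℕ → ℕ → Set
DesignFin a b c = Design (Fin a) (Fin b) (Fin c)

blockSumFin : ∀ {a b c a′ b′ c′} → DesignFin a b c → DesignFin a′ b′ c′ →
  DesignFin (a + a′) (b + b′) (c + c′)
blockSumFin D E = relabel (↔-sym +↔⊎) (↔-sym +↔⊎) (↔-sym +↔⊎) (blockSum D E)

addTwoRowsFin : ∀ {a b c} m → 3 ≤ m → m ≤ b → DesignFin a b c → DesignFin (2 + a) b (m + c)
addTwoRowsFin m 3≤m m≤b D =
  relabel (↔-sym +↔⊎ ↔-∘ (↔-sym 2↔Bool ⊎-↔ ↔-id _)) (↔-id _) (↔-sym +↔⊎) (addTwoRows m 3≤m m≤b D)

-- Small designs given by tables

Table : ℕ → ℕ → ℕ → Set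
Table a b n = Vec ((Fin a × Fin b) × (Fin a × Fin b)) n

cell : ∀ {a b n} → Table a b n → Fin n → Bool → Fin a × Fin b
cell t k false = proj₁ (lookup t k)
cell t k true  = proj₂ (lookup t k)

module _ {a b n} (t : Table a b n) (m : ℕ) where

  private
    row : Fin n → Bool → Fin a
    row k ε = proj₁ (cell t k ε)
    col : Fin n → Bool → Fin b
    col k ε = proj₂ (cell t k ε)

  -- Every prefix of the table of length at least m is then a design.
  IsDesignFrom : Set
  IsDesignFrom =
      (∀ k → row k false ≢ row k true)
    × (∀ k → col k false ≢ col k true)
    × (∀ δ k l ε η → row k ε ≡ row l η → col k (δ xor ε) ≡ col l (δ xor η) → k ≡ l)
    × (∀ i → Thrice λ k → toℕ k < m × Meets row i k)
    × (∀ j → Thrice λ k → toℕ k < m × Meets col j k)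

  allᵇ? : {P : Bool → Set} → (∀ ε → Dec (P ε)) → Dec (∀ ε → P ε)
  allᵇ? P? = map′ (λ { (f , t) false → f ; (f , t) true → t }) (λ p → p false , p true)
    (P? false ×-dec P? true)

  anyᵇ? : {P : Bool → Set} → (∀ ε → Dec (P ε)) → Dec (∃[ ε ] P ε)
  anyᵇ? P? = map′ (λ { (inj₁ p) → false , p ; (inj₂ p) → true , p })
    (λ { (false , p) → inj₁ p ; (true , p) → inj₂ p }) (P? false ⊎-dec P? true)

  isDesignFrom? : Dec IsDesignFrom
  isDesignFrom? =
    all? (λ k → ¬? (row k false ≟ row k true)) ×-dec
    all? (λ k → ¬? (col k false ≟ col k true)) ×-dec
    allᵇ? (λ δ → all? λ k → all? λ l → allᵇ? λ ε → allᵇ? λ η →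
      (row k ε ≟ row l η) →-dec (col k (δ xor ε) ≟ col l (δ xor η)) →-dec (k ≟ l)) ×-dec
    all? (λ i → Thrice? λ k → (toℕ k <? m) ×-dec anyᵇ? λ ε → row k ε ≟ i) ×-dec
    all? (λ j → Thrice? λ k → (toℕ k <? m) ×-dec anyᵇ? λ ε → col k ε ≟ j)

  -- Distinctness restricts to every prefix, and the `Thrice` witnesses, of index below `m`, survive
  -- in every prefix of length at least `m`.
  tableDesign : IsDesignFrom → ∀ {c} → m ≤ c → c ≤ n → DesignFin a b c
  tableDesign (row-≢ , col-≢ , pair-inj , row-thrice , col-thrice) {c} m≤c c≤n = record
    { pairing = record
      { row      = row ∘ inj
      ; col      = col ∘ inj
      ; row-≢    = row-≢ ∘ inj
      ; col-≢    = col-≢ ∘ inj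
      ; pair-inj = λ δ ε η r s → inject≤-injective c≤n c≤n _ _ (pair-inj δ _ _ ε η r s)
      }
    ; row-thrice = thrice row ∘ row-thrice
    ; col-thrice = thrice col ∘ col-thrice
    }
    where
    inj : Fin c → Fin n
    inj k = inject≤ k c≤n
    shrink : (k : Fin n) → toℕ k < m → Fin c
    shrink k k<m = fromℕ< (<-≤-trans k<m m≤c)
    toℕ-shrink : ∀ k k<m → toℕ (shrink k k<m) ≡ toℕ k
    toℕ-shrink k k<m = toℕ-fromℕ< _
    thrice : ∀ {X : Set} (line : Fin n → Bool → X) {x} →
      Thrice (λ k → toℕ k < m × Meets line x k) → Thrice (Meets (line ∘ inj) x)
    thrice line = Thrice-map (λ k (k<m , _) → shrink k k<m)
      (λ {k} {l} (k<m , _) (l<m , _) e → toℕ-injective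
        (trans (sym (toℕ-shrink k k<m)) (trans (cong toℕ e) (toℕ-shrink l l<m))))
      (λ k (k<m , ε , e) → ε , trans
        (cong (λ l → line l ε) (toℕ-injective (trans (toℕ-inject≤ _ c≤n) (toℕ-shrink k k<m)))) e)

-- This and the other tables with `a` = `b` + 1 list the cells (t mod `a`, t mod `b`), t = 0, 1, 2,
-- ..., in consecutive pairs; the sides being coprime, no cell recurs within `a * b` steps.
design4×3 : ∀ {c} → 6 ≤ c → c ≤ 6 → DesignFin 4 3 c
design4×3 = tableDesign table 6 (from-yes (isDesignFrom? table 6))
  where
  table : Table 4 3 6
  table =
    ((0F , 0F) , (1F , 1F)) ∷ ((2F , 2F) , (3F , 0F)) ∷ ((0F , 1F) , (1F , 2F)) ∷
    ((2F , 0F) , (3F , 1F)) ∷ ((0F , 2F) , (1F , 0F)) ∷ ((2F , 1F) , (3F , 2F)) ∷ []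

-- The cyclic diagonals are listed one after another; having even length, they split into
-- consecutive pairs. The 6 × 6 table follows the same scheme.
design4×4 : ∀ {c} → 6 ≤ c → c ≤ 8 → DesignFin 4 4 c
design4×4 = tableDesign table 6 (from-yes (isDesignFrom? table 6))
  where
  table : Table 4 4 8
  table =
    ((0F , 0F) , (1F , 1F)) ∷ ((2F , 2F) , (3F , 3F)) ∷ ((0F , 1F) , (1F , 2F)) ∷
    ((2F , 3F) , (3F , 0F)) ∷ ((0F , 2F) , (1F , 3F)) ∷ ((2F , 0F) , (3F , 1F)) ∷
    ((0F , 3F) , (1F , 0F)) ∷ ((2F , 1F) , (3F , 2F)) ∷ []

design5×4 : ∀ {c} → 8 ≤ c → c ≤ 10 → DesignFin 5 4 c
design5×4 = tableDesign table 8 (from-yes (isDesignFrom? table 8))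
  where
  table : Table 5 4 10
  table =
    ((0F , 0F) , (1F , 1F)) ∷ ((2F , 2F) , (3F , 3F)) ∷ ((4F , 0F) , (0F , 1F)) ∷
    ((1F , 2F) , (2F , 3F)) ∷ ((3F , 0F) , (4F , 1F)) ∷ ((0F , 2F) , (1F , 3F)) ∷
    ((2F , 0F) , (3F , 1F)) ∷ ((4F , 2F) , (0F , 3F)) ∷ ((1F , 0F) , (2F , 1F)) ∷
    ((3F , 2F) , (4F , 3F)) ∷ []

-- Cyclic diagonals of odd length do not split into pairs, so this table and the 7 × 7 one are
-- irregular.
design5×5 : ∀ {c} → 8 ≤ c → c ≤ 12 → DesignFin 5 5 c
design5×5 = tableDesign table 8 (from-yes (isDesignFrom? table 8))
  where
  table : Table 5 5 12
  table =
    ((0F , 0F) , (2F , 1F)) ∷ ((1F , 1F) , (2F , 0F)) ∷ ((0F , 1F) , (1F , 2F)) ∷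
    ((0F , 2F) , (1F , 0F)) ∷ ((3F , 1F) , (4F , 2F)) ∷ ((3F , 3F) , (4F , 4F)) ∷
    ((4F , 3F) , (3F , 4F)) ∷ ((2F , 3F) , (0F , 4F)) ∷ ((3F , 0F) , (4F , 1F)) ∷
    ((3F , 2F) , (4F , 0F)) ∷ ((0F , 3F) , (1F , 4F)) ∷ ((1F , 3F) , (2F , 4F)) ∷ []

design6×5 : ∀ {c} → 9 ≤ c → c ≤ 10 → DesignFin 6 5 c
design6×5 = tableDesign table 9 (from-yes (isDesignFrom? table 9))
  where
  table : Table 6 5 10
  table =
    ((0F , 0F) , (1F , 1F)) ∷ ((2F , 2F) , (3F , 3F)) ∷ ((4F , 4F) , (5F , 0F)) ∷
    ((0F , 1F) , (1F , 2F)) ∷ ((2F , 3F) , (3F , 4F)) ∷ ((4F , 0F) , (5F , 1F)) ∷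
    ((0F , 2F) , (1F , 3F)) ∷ ((2F , 4F) , (3F , 0F)) ∷ ((4F , 1F) , (5F , 2F)) ∷
    ((0F , 3F) , (1F , 4F)) ∷ []

design6×6 : ∀ {c} → 9 ≤ c → c ≤ 11 → DesignFin 6 6 c
design6×6 = tableDesign table 9 (from-yes (isDesignFrom? table 9))
  where
  table : Table 6 6 11
  table =
    ((0F , 0F) , (1F , 1F)) ∷ ((2F , 2F) , (3F , 3F)) ∷ ((4F , 4F) , (5F , 5F)) ∷
    ((0F , 1F) , (1F , 2F)) ∷ ((2F , 3F) , (3F , 4F)) ∷ ((4F , 5F) , (5F , 0F)) ∷
    ((0F , 2F) , (1F , 3F)) ∷ ((2F , 4F) , (3F , 5F)) ∷ ((4F , 0F) , (5F , 1F)) ∷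
    ((0F , 3F) , (1F , 4F)) ∷ ((2F , 5F) , (3F , 0F)) ∷ []

design7×6 : ∀ {c} → 11 ≤ c → c ≤ 11 → DesignFin 7 6 c
design7×6 = tableDesign table 11 (from-yes (isDesignFrom? table 11))
  where
  table : Table 7 6 11
  table =
    ((0F , 0F) , (1F , 1F)) ∷ ((2F , 2F) , (3F , 3F)) ∷ ((4F , 4F) , (5F , 5F)) ∷
    ((6F , 0F) , (0F , 1F)) ∷ ((1F , 2F) , (2F , 3F)) ∷ ((3F , 4F) , (4F , 5F)) ∷
    ((5F , 0F) , (6F , 1F)) ∷ ((0F , 2F) , (1F , 3F)) ∷ ((2F , 4F) , (3F , 5F)) ∷
    ((4F , 0F) , (5F , 1F)) ∷ ((6F , 2F) , (0F , 3F)) ∷ []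

design7×7 : ∀ {c} → 11 ≤ c → c ≤ 13 → DesignFin 7 7 c
design7×7 = tableDesign table 11 (from-yes (isDesignFrom? table 11))
  where
  table : Table 7 7 13
  table =
    ((0F , 5F) , (1F , 6F)) ∷ ((2F , 6F) , (4F , 3F)) ∷ ((3F , 1F) , (4F , 4F)) ∷
    ((4F , 0F) , (5F , 3F)) ∷ ((0F , 2F) , (6F , 5F)) ∷ ((1F , 3F) , (3F , 6F)) ∷
    ((1F , 4F) , (2F , 1F)) ∷ ((3F , 4F) , (5F , 1F)) ∷ ((0F , 4F) , (6F , 0F)) ∷
    ((2F , 2F) , (4F , 5F)) ∷ ((5F , 0F) , (6F , 2F)) ∷ ((3F , 3F) , (5F , 6F)) ∷
    ((5F , 5F) , (6F , 6F)) ∷ []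

-- Existence of designs

cancel-≤ : ∀ k {m n x y} → x ≤ y → k + m ≡ x → y ≡ k + n → m ≤ n
cancel-≤ k {m} {n} x≤y e f = +-cancelˡ-≤ k m n (subst₂ _≤_ (sym e) f x≤y)

-- Polynomial inequalities are proved by naming the difference, a polynomial with natural
-- coefficients, and leaving the identity to the ring solver.
by-difference : ∀ {m n} k → m + k ≡ n → m ≤ n
by-difference {m} k e = subst (m ≤_) e (m≤m+n m k)

-- The bounds are the necessary counting conditions: `2 * c` distinct cells, at least three on each
-- line.
Designs : ℕ → ℕ → Set
Designs a b = ∀ c → 3 * a ≤ 2 * c → 3 * b ≤ 2 * c → 2 * c ≤ a * b → DesignFin a b c

transposeDesigns : ∀ a b → Designs a b → Designs b a
transposeDesigns a b designs c 3b≤2c 3a≤2c 2c≤ba =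
  transpose (designs c 3a≤2c 3b≤2c (subst (2 * c ≤_) (*-comm b a) 2c≤ba))

-- Adding 3 pairs if that leaves a feasible number of pairs for the a × b grid,
-- and as many as possible otherwise.
addTwoRowsTo : ∀ a b c → Designs a b →
  3 ≤ b → 3 * a + 2 * b ≤ a * b + 7 → 5 * b ≤ a * b + 7 →
  6 + 3 * a ≤ 2 * c → 6 + 3 * b ≤ 2 * c → 2 * c ≤ (2 + a) * b →
  DesignFin (2 + a) b c
addTwoRowsTo a b c designs 3≤b slack₁ slack₂ lower₁ lower₂ upper
  with d , refl ← m≤n⇒∃[o]m+o≡n {3} {c} (*-cancelˡ-≤ 2 (m+n≤o⇒m≤o 6 lower₁))
  = add (2 * d ≤? a * b)
  where
  3a≤2d : 3 * a ≤ 2 * d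
  3a≤2d = cancel-≤ 6 lower₁ refl (*-distribˡ-+ 2 3 d)
  3b≤2d : 3 * b ≤ 2 * d
  3b≤2d = cancel-≤ 6 lower₂ refl (*-distribˡ-+ 2 3 d)
  add : Dec (2 * d ≤ a * b) → DesignFin (2 + a) b (3 + d)
  add (yes 2d≤ab) = addTwoRowsFin 3 ≤-refl 3≤b (designs d 3a≤2d 3b≤2d 2d≤ab)
  add (no  2d≰ab)
    with f , refl ← m≤n⇒∃[o]m+o≡n 3≤b
    with e , refl ← m≤n⇒∃[o]m+o≡n {f} {d} (*-cancelˡ-≤ 2
           (≤-trans (by-difference {2 * f} {3 * (3 + f)} (9 + f) (solve (f List.∷ List.[]))) 3b≤2d))
    -- With `b` = `3 + f` pairs added, `e` remain, and 2e = 2d + 6 - 2b ≥ ab + 7 - 2b; the slack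
    -- hypotheses bound this below by 3a and by 3b.
    = addTwoRowsFin (3 + f) 3≤b ≤-refl (designs e
        (cancel-≤ (1 + a * (3 + f) + 2 * (3 + f)) (+-mono-≤ (≰⇒> 2d≰ab) slack₁)
          (shift₁ a f) (shift₂ a e f))
        (cancel-≤ (1 + a * (3 + f) + 2 * (3 + f)) (+-mono-≤ (≰⇒> 2d≰ab) slack₂)
          (shift₃ a f) (shift₂ a e f))
        (cancel-≤ (2 * (3 + f)) upper (shift₄ e f) (*-distribʳ-+ (3 + f) 2 a)))
    where
    shift₁ : ∀ a f → 1 + a * (3 + f) + 2 * (3 + f) + 3 * a ≡ suc (a * (3 + f)) + (3 * a + 2 * (3 + f))
    shift₁ = solve-∀
    shift₂ : ∀ a e f → 2 * (f + e) + (a * (3 + f) + 7) ≡ 1 + a * (3 + f) + 2 * (3 + f) + 2 * e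
    shift₂ = solve-∀
    shift₃ : ∀ a f → 1 + a * (3 + f) + 2 * (3 + f) + 3 * (3 + f) ≡ suc (a * (3 + f)) + 5 * (3 + f)
    shift₃ = solve-∀
    shift₄ : ∀ e f → 2 * (3 + f) + 2 * e ≡ 2 * (3 + (f + e))
    shift₄ = solve-∀

n≤2*⌈n/2⌉ : ∀ n → n ≤ 2 * ⌈ n /2⌉
n≤2*⌈n/2⌉ 0 = z≤n
n≤2*⌈n/2⌉ 1 = s≤s z≤n
n≤2*⌈n/2⌉ (suc (suc n)) =
  subst (2 + n ≤_) (sym (*-suc 2 ⌈ n /2⌉)) (+-monoʳ-≤ 2 (n≤2*⌈n/2⌉ n))

2*⌈n/2⌉≤1+n : ∀ n → 2 * ⌈ n /2⌉ ≤ 1 + n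
2*⌈n/2⌉≤1+n 0 = z≤n
2*⌈n/2⌉≤1+n 1 = ≤-refl
2*⌈n/2⌉≤1+n (suc (suc n)) =
  subst (_≤ 3 + n) (sym (*-suc 2 ⌈ n /2⌉)) (+-monoʳ-≤ 2 (2*⌈n/2⌉≤1+n n))

-- The `a × b` block receives the least feasible number `h` of pairs; the bounds on `c` leave
-- between 6 and 8 for the 4 × 4 block.
addBlock4×4To : ∀ a b c →
  Designs a b → b ≤ a → 2 * ⌈ 3 * a /2⌉ ≤ a * b →
  3 * (4 + a) ≤ 2 * c → 2 * c < 3 * (4 + b) + 6 →
  DesignFin (4 + a) (4 + b) c
addBlock4×4To a b c designs b≤a ⌈3a⌉≤ab lower upper =
  subst (DesignFin (4 + a) (4 + b)) (m∸n+n≡m (≤-trans (m≤n+m h 6) 6+h≤c))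
    (blockSumFin (design4×4 (m+n≤o⇒m≤o∸n 6 6+h≤c) (m≤n+o⇒m∸n≤o c h c≤h+8))
      (designs h (n≤2*⌈n/2⌉ (3 * a)) (≤-trans (*-monoʳ-≤ 3 b≤a) (n≤2*⌈n/2⌉ (3 * a))) ⌈3a⌉≤ab))
  where
  h = ⌈ 3 * a /2⌉
  double-suc : ∀ c n → suc (2 * c + suc n) ≡ n + 2 * suc c
  double-suc = solve-∀
  6+h≤c : 6 + h ≤ c
  -- Rounding in `h` loses 1: only 2(6 + h) ≤ 2c + 1 follows, and parity recovers the bound.
  6+h≤c = ≤-pred (*-cancelˡ-< 2 _ _
    (cancel-≤ (3 * a) (s≤s (+-mono-≤ lower (2*⌈n/2⌉≤1+n (3 * a)))) (shift a h) (double-suc c (3 * a))))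
    where
    shift : ∀ a h → 3 * a + suc (2 * (6 + h)) ≡ suc (3 * (4 + a) + 2 * h)
    shift = solve-∀
  c≤h+8 : c ≤ h + 8
  c≤h+8 = ≤-pred (*-cancelˡ-< 2 _ _
    (cancel-≤ (3 * a) (+-mono-≤ (≤-trans upper (+-monoˡ-≤ 6 (*-monoʳ-≤ 3 (+-monoʳ-≤ 4 b≤a)))) (n≤2*⌈n/2⌉ (3 * a)))
      (+-comm (3 * a) _) (shift a h)))
    where
    shift : ∀ a h → 3 * (4 + a) + 6 + 2 * h ≡ 3 * a + 2 * suc (h + 8)
    shift = solve-∀

-- The recursion for nearly square grids (o ≤ 1): with 2c ≥ 3b + 6 two rows can be added to a
-- wider grid; otherwise a 4 × 4 block is split off, except for the sizes given by tables.
designs : ∀ o b → Acc _<_ (o + (b + b)) → 3 ≤ b → Designs (o + b) b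
designs (suc (suc o)) b@(suc (suc (suc f))) (acc rs) 3≤b c 3a≤2c _ 2c≤ab =
  -- Removing two rows lowers the difference of the sides by 2. The recursion is on `o + (b + b)`,
  -- the sum of the sides.
  addTwoRowsTo (o + b) b c (designs o b (rs (m≤n+m _ 1)) 3≤b) 3≤b
    (by-difference (1 + f + f * f + o * f) (solve (o List.∷ f List.∷ List.[])))
    (by-difference (1 + f + f * f + o * (3 + f)) (solve (o List.∷ f List.∷ List.[])))
    6+3a≤2c
    (≤-trans (+-monoʳ-≤ 6 (*-monoʳ-≤ 3 (m≤n+m b o))) 6+3a≤2c) 2c≤ab
  where
  6+3a≤2c : 6 + 3 * (o + b) ≤ 2 * c
  6+3a≤2c = subst (_≤ 2 * c) (*-distribˡ-+ 3 2 (o + b)) 3a≤2c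
designs _ 1 _ (s≤s ())
designs _ 2 _ (s≤s (s≤s ()))
-- Nine cells cannot be split into pairs.
designs 0 3 _ _ c 9≤2c _ 2c≤9 = contradiction (≤-antisym 2c≤9 9≤2c) (even≢odd c 4)
designs 1 3 _ _ c 12≤2c _ 2c≤12 = design4×3 (*-cancelˡ-≤ 2 12≤2c) (*-cancelˡ-≤ 2 2c≤12)
designs 0 4 _ _ c 12≤2c _ 2c≤16 = design4×4 (*-cancelˡ-≤ 2 12≤2c) (*-cancelˡ-≤ 2 2c≤16)
designs 1 4 _ _ c 15≤2c _ 2c≤20 = design5×4 (*-cancelˡ-< 2 7 c 15≤2c) (*-cancelˡ-≤ 2 2c≤20)
designs 0 5 _ _ c 15≤2c _ 2c≤25 = design5×5 (*-cancelˡ-< 2 7 c 15≤2c) (≤-pred (*-cancelˡ-< 2 c 13 (s≤s 2c≤25)))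
designs 0 b@(suc (suc (suc (suc (suc (suc j)))))) (acc rs) 3≤b c 3a≤2c _ 2c≤ab with 6 + 3 * b ≤? 2 * c
... | yes large =
  -- Without two rows the grid is wider than high, so the recursive call is on its transpose.
  addTwoRowsTo (4 + j) b c
    (transposeDesigns (6 + j) (4 + j) (designs 2 (4 + j) (rs (by-difference 1 (solve (j List.∷ List.[])))) (m≤m+n 3 _)))
    3≤b (by-difference (7 + 5 * j + j * j) (solve (j List.∷ List.[])))
    (by-difference (1 + 5 * j + j * j) (solve (j List.∷ List.[])))
    (≤-trans (+-monoʳ-≤ 6 (*-monoʳ-≤ 3 (m≤n+m (4 + j) 2))) large) large 2c≤ab
... | no ¬large = few j rs 3a≤2c (≰⇒> ¬large)
  where
  few : ∀ j → (∀ {m} → m < (6 + j) + (6 + j) → Acc _<_ m) →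
    3 * (6 + j) ≤ 2 * c → 2 * c < 6 + 3 * (6 + j) → DesignFin (6 + j) (6 + j) c
  -- Splitting off a 4 × 4 block would leave a 2 × 2 or 3 × 3 grid here and in the next case;
  -- neither carries a design.
  few 0 _ 18≤2c 2c<24 = design6×6 (*-cancelˡ-≤ 2 18≤2c) (≤-pred (*-cancelˡ-< 2 c 12 2c<24))
  few 1 _ 21≤2c 2c<27 = design7×7 (*-cancelˡ-< 2 10 c 21≤2c) (≤-pred (*-cancelˡ-< 2 c 14 (m≤n⇒m≤1+n 2c<27)))
  few (suc (suc i)) rs lower upper =
    addBlock4×4To (4 + i) (4 + i) c
      (designs 0 (4 + i) (rs (by-difference 7 (solve (i List.∷ List.[])))) (m≤m+n 3 _)) ≤-refl
      (≤-trans (2*⌈n/2⌉≤1+n (3 * (4 + i))) (by-difference (3 + 5 * i + i * i) (solve (i List.∷ List.[]))))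
      lower (subst (2 * c <_) (+-comm 6 _) upper)
designs 1 b@(suc (suc (suc (suc (suc j))))) (acc rs) 3≤b c 3a≤2c _ 2c≤ab with 6 + 3 * b ≤? 2 * c
... | yes large =
  addTwoRowsTo (4 + j) b c
    (transposeDesigns (5 + j) (4 + j) (designs 1 (4 + j) (rs (by-difference 1 (solve (j List.∷ List.[])))) (m≤m+n 3 _)))
    3≤b (by-difference (5 + 4 * j + j * j) (solve (j List.∷ List.[])))
    (by-difference (2 + 4 * j + j * j) (solve (j List.∷ List.[])))
    (≤-trans (+-monoʳ-≤ 6 (*-monoʳ-≤ 3 (m≤n+m (4 + j) 1))) large) large 2c≤ab
... | no ¬large = few j rs 3a≤2c (≰⇒> ¬large)
  where
  few : ∀ j → (∀ {m} → m < 1 + ((5 + j) + (5 + j)) → Acc _<_ m) →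
    3 * (6 + j) ≤ 2 * c → 2 * c < 6 + 3 * (5 + j) → DesignFin (6 + j) (5 + j) c
  few 0 _ 18≤2c 2c<21 = design6×5 (*-cancelˡ-≤ 2 18≤2c) (≤-pred (*-cancelˡ-< 2 c 11 (m≤n⇒m≤1+n 2c<21)))
  few 1 _ 21≤2c 2c<24 = design7×6 (*-cancelˡ-< 2 10 c 21≤2c) (≤-pred (*-cancelˡ-< 2 c 12 2c<24))
  -- The remaining 4 × 3 grid is filled completely, so the estimate 3a + 1 ≤ ab of the next case
  -- fails.
  few 2 rs lower upper =
    addBlock4×4To 4 3 c (designs 1 3 (rs (m≤m+n 8 7)) ≤-refl) (m≤m+n 3 1) ≤-refl
      lower upper
  few (suc (suc (suc i))) rs lower upper =
    addBlock4×4To (5 + i) (4 + i) c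
      (designs 1 (4 + i) (rs (by-difference 7 (solve (i List.∷ List.[])))) (m≤m+n 3 _)) (m≤n+m _ 1)
      (≤-trans (2*⌈n/2⌉≤1+n (3 * (5 + i))) (by-difference (4 + 6 * i + i * i) (solve (i List.∷ List.[]))))
      lower (subst (2 * c <_) (+-comm 6 _) upper)

-- The upper bound

Triple : ℕ → ℕ → ℕ → Set
Triple a b c = Fin (suc a) × Fin (suc b) × Fin (suc c)

Agree : ∀ {a b c} → Triple a b c → Triple a b c → Set
Agree (x₁ , x₂ , x₃) (w₁ , w₂ , w₃) = x₁ ≡ w₁ ⊎ x₂ ≡ w₂ ⊎ x₃ ≡ w₃

-- The shifts reserve the value zero of each coordinate for `origin`.
vertex : ∀ {a b c} → DesignFin a b c → Fin c → Bool → Triple a b c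
vertex D k ε = suc (row k ε) , suc (col k ε) , suc k
  where open Design D

swap₁₂ : ∀ {a b c} → Triple a b c → Triple b a c
swap₁₂ (x₁ , x₂ , x₃) = x₂ , x₁ , x₃

Agree-swap₁₂ : ∀ {a b c} (x y : Triple a b c) → Agree x y → Agree (swap₁₂ x) (swap₁₂ y)
Agree-swap₁₂ _ _ (inj₁ e)        = inj₂ (inj₁ e)
Agree-swap₁₂ _ _ (inj₂ (inj₁ e)) = inj₁ e
Agree-swap₁₂ _ _ (inj₂ (inj₂ e)) = inj₂ (inj₂ e)

Thrice-pigeonhole : {I : Set} {P Q R : I → Set} → Thrice P → (∀ k → P k → Q k ⊎ R k) →
  (∀ {k l} → Q k → Q l → k ≡ l) → (∀ {k l} → R k → R l → k ≡ l) → ⊥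
Thrice-pigeonhole (k₁ , p₁ , k₂ , p₂ , k₁≢k₂ , k₃ , p₃ , k₁≢k₃ , k₂≢k₃) P⇒ Q! R!
  with P⇒ k₁ p₁ | P⇒ k₂ p₂ | P⇒ k₃ p₃
... | inj₁ q₁ | inj₁ q₂ | _       = k₁≢k₂ (Q! q₁ q₂)
... | inj₁ q₁ | inj₂ r₂ | inj₁ q₃ = k₁≢k₃ (Q! q₁ q₃)
... | inj₁ q₁ | inj₂ r₂ | inj₂ r₃ = k₂≢k₃ (R! r₂ r₃)
... | inj₂ r₁ | inj₂ r₂ | _       = k₁≢k₂ (R! r₁ r₂)
... | inj₂ r₁ | inj₁ q₂ | inj₁ q₃ = k₂≢k₃ (Q! q₂ q₃)
... | inj₂ r₁ | inj₁ q₂ | inj₂ r₃ = k₁≢k₃ (R! r₁ r₃)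

module _ {a b c} (D : DesignFin a b c) where
  open Design D

  -- A column and a pair contain at most one cell of row i each, so they cannot cover three.
  row-determined : ∀ x₁ x₂ x₃ y₁ y₂ y₃ →
    (∀ k ε → Agree (x₁ , x₂ , x₃) (vertex D k ε) → Agree (y₁ , y₂ , y₃) (vertex D k ε)) →
    ∀ {i} → x₁ ≡ suc i → x₁ ≡ y₁
  row-determined x₁ x₂ x₃ y₁ y₂ y₃ h {i} refl with suc i ≟ y₁
  ... | yes e = e
  ... | no x₁≢y₁ = ⊥-elim
    (Thrice-pigeonhole {Q = λ k → ∃[ ε ] row k ε ≡ i × y₂ ≡ suc (col k ε)} {R = λ k → y₃ ≡ suc k}
      (row-thrice i) cases
      (λ { (ε , r , e) (η , s , f) → pair-inj false ε η (trans r (sym s)) (suc-injective (trans (sym e) f)) })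
      (λ e f → suc-injective (trans (sym e) f)))
    where
    cases : ∀ k → Meets row i k → (∃[ ε ] row k ε ≡ i × y₂ ≡ suc (col k ε)) ⊎ y₃ ≡ suc k
    cases k (ε , r) with h k ε (inj₁ (cong suc (sym r)))
    ... | inj₁ e        = contradiction (sym (trans e (cong suc r))) x₁≢y₁
    ... | inj₂ (inj₁ e) = inj₁ (ε , r , e)
    ... | inj₂ (inj₂ e) = inj₂ e

  -- Both cells of pair `k` must be met by the first two coordinates of `y`. They lie on distinct
  -- lines, so one is met by row and the other by column.
  corner : ∀ {x₁ x₂ y₁ y₂ y₃ k} →
    (∀ ε → Agree (x₁ , x₂ , suc k) (vertex D k ε) → Agree (y₁ , y₂ , y₃) (vertex D k ε)) →
    suc k ≢ y₃ → ∃[ ε ] y₁ ≡ suc (row k ε) × y₂ ≡ suc (col k (not ε))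
  corner {k = k} h k≢y₃ with h false (inj₂ (inj₂ refl)) | h true (inj₂ (inj₂ refl))
  ... | inj₂ (inj₂ e) | _             = contradiction (sym e) k≢y₃
  ... | _             | inj₂ (inj₂ e) = contradiction (sym e) k≢y₃
  ... | inj₁ r        | inj₁ s        = contradiction (suc-injective (trans (sym r) s)) (row-≢ k)
  ... | inj₂ (inj₁ e) | inj₂ (inj₁ f) = contradiction (suc-injective (trans (sym e) f)) (col-≢ k)
  ... | inj₁ r        | inj₂ (inj₁ f) = false , r , f
  ... | inj₂ (inj₁ e) | inj₁ s        = true , s , e

  -- One coordinate of x being zero, only one line of x can meet row i, and it does so at most once.
  free-cell : (x₁ : Fin (suc a)) (x₂ : Fin (suc b)) (x₃ : Fin (suc c)) →
    ∀ {i} → x₁ ≢ suc i → x₂ ≡ zero ⊎ x₃ ≡ zero →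
    ∃[ k ] ∃[ ε ] x₁ ≢ suc (row k ε) × x₂ ≢ suc (col k ε) × x₃ ≢ suc k
  free-cell x₁ x₂ x₃ {i} x₁≢i zero∈x
    with k , (ε , r) , l , (η , s) , k≢l , _ ← row-thrice i
    with zero∈x
  ... | inj₁ refl with x₃ ≟ suc k
  ...   | no  x₃≢k = k , ε , (λ e → x₁≢i (trans e (cong suc r))) , (λ ()) , x₃≢k
  ...   | yes refl = l , η , (λ e → x₁≢i (trans e (cong suc s))) , (λ ()) , k≢l ∘ suc-injective
  free-cell x₁ x₂ x₃ {i} x₁≢i zero∈x | inj₂ refl with x₂ ≟ suc (col k ε)
  ...   | no  x₂≢k = k , ε , (λ e → x₁≢i (trans e (cong suc r))) , x₂≢k , (λ ())
  ...   | yes refl = l , η , (λ e → x₁≢i (trans e (cong suc s))) ,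
    (λ e → k≢l (pair-inj false ε η (trans r (sym s)) (suc-injective e))) , (λ ())

other-line : ∀ {n} → 2 ≤ n → (x : Fin (suc n)) → ∃[ i ] x ≢ suc i
other-line (s≤s (s≤s _)) 1F = 1F , λ ()
other-line (s≤s (s≤s _)) 0F = 0F , λ ()
other-line (s≤s (s≤s _)) (suc (suc x)) = 0F , λ ()

-- The vertex set of a design resolves and totally dominates

module _ {a b c} (D : DesignFin a b c) where
  open Design D

  private
    G = K (suc a) ⊗ K (suc b) ⊗ K (suc c)

  origin : Triple a b c
  origin = zero , zero , zero

  designSet : List (Triple a b c)
  designSet = origin ∷ cartesianProductWith (vertex D) (allFin c) (false ∷ true ∷ [])

  vertex∈designSet : ∀ k ε → vertex D k ε ∈ designSet
  vertex∈designSet k ε = there (∈-cartesianProductWith⁺ (vertex D) (∈-allFin k) (∈-bool ε))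
    where
    ∈-bool : ∀ ε → ε ∈ false ∷ true ∷ []
    ∈-bool false = here refl
    ∈-bool true  = there (here refl)

  designSet-unique : Unique designSet
  designSet-unique =
    All.tabulate (λ v∈ e → origin∉ (subst (_∈ _) (sym e) v∈)) ∷
    cartesianProductWith⁺ (vertex D) vertex-injective (allFin⁺ c) (((λ ()) ∷ []) ∷ [] ∷ [])
    where
    origin∉ : ¬ origin ∈ cartesianProductWith (vertex D) (allFin c) (false ∷ true ∷ [])
    origin∉ o∈ with ∈-cartesianProductWith⁻ (vertex D) (allFin c) _ o∈
    ... | _ , _ , _ , _ , ()
    vertex-injective : ∀ {k l ε η} → vertex D k ε ≡ vertex D l η → k ≡ l × ε ≡ η
    vertex-injective {k} {l} {ε} {η} e with suc-injective (cong (proj₂ ∘ proj₂) e)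
    ... | refl = refl , row-injective ε η (suc-injective (cong proj₁ e))
      where
      row-injective : ∀ ε η → row k ε ≡ row k η → ε ≡ η
      row-injective false false _ = refl
      row-injective false true  e = contradiction e (row-≢ k)
      row-injective true  false e = contradiction (sym e) (row-≢ k)
      row-injective true  true  _ = refl

  designSet-length : length designSet ≡ suc (2 * c)
  designSet-length = cong suc (trans (doubles (allFin c)) (trans (cong (_* 2) (length-tabulate {n = c} id)) (*-comm c 2)))
    where
    doubles : ∀ ks → length (cartesianProductWith (vertex D) ks (false ∷ true ∷ [])) ≡ length ks * 2
    doubles []       = refl
    doubles (k ∷ ks) = cong (2 +_) (doubles ks)

  agreement-determines : ∀ x y →
    (∀ {w} → w ∈ designSet → Agree x w → Agree y w) → (∀ {w} → w ∈ designSet → Agree y w → Agree x w) → x ≡ y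
  agreement-determines x@(x₁ , x₂ , x₃) y@(y₁ , y₂ , y₃) x⇒y y⇒x =
    cong₂ _,_ x₁≡y₁ (cong₂ _,_ x₂≡y₂ x₃≡y₃)
    where
    -- `row-determined` covers nonzero coordinates; used in both directions it leaves only the case
    -- of two zeros.
    both : ∀ {n} {u v : Fin (suc n)} → (∀ {i} → u ≡ suc i → u ≡ v) → (∀ {i} → v ≡ suc i → v ≡ u) → u ≡ v
    both {u = zero}  {zero}  f g = refl
    both {u = zero}  {suc _} f g = sym (g refl)
    both {u = suc _}         f g = f refl

    x₁≡y₁ : x₁ ≡ y₁
    x₁≡y₁ = both
      (row-determined D x₁ x₂ x₃ y₁ y₂ y₃ (λ k ε → x⇒y (vertex∈designSet k ε)))
      (row-determined D y₁ y₂ y₃ x₁ x₂ x₃ (λ k ε → y⇒x (vertex∈designSet k ε)))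

    x₂≡y₂ : x₂ ≡ y₂
    x₂≡y₂ = both
      -- The vertices of `transpose D` are those of `D` with the first two coordinates swapped.
      (row-determined (transpose D) x₂ x₁ x₃ y₂ y₁ y₃
        (λ k ε → Agree-swap₁₂ y _ ∘ x⇒y (vertex∈designSet k ε) ∘ Agree-swap₁₂ (swap₁₂ x) _))
      (row-determined (transpose D) y₂ y₁ y₃ x₂ x₁ x₃
        (λ k ε → Agree-swap₁₂ x _ ∘ y⇒x (vertex∈designSet k ε) ∘ Agree-swap₁₂ (swap₁₂ y) _))

    no-zero : ∀ {k l m} → ¬ Agree (suc k , suc l , suc m) origin
    no-zero (inj₁ ())
    no-zero (inj₂ (inj₁ ()))
    no-zero (inj₂ (inj₂ ()))

    third-determined : ∀ x₁ x₂ x₃ y₃ →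
      (∀ {w} → w ∈ designSet → Agree (x₁ , x₂ , x₃) w → Agree (x₁ , x₂ , y₃) w) →
      (∀ {w} → w ∈ designSet → Agree (x₁ , x₂ , y₃) w → Agree (x₁ , x₂ , x₃) w) → x₃ ≡ y₃
    third-determined x₁ x₂ zero zero _ _ = refl
    third-determined x₁ x₂ (suc k) zero x⇒y y⇒x
      with ε , refl , refl ← corner D (λ ε → x⇒y (vertex∈designSet k ε)) (λ ())
      -- At a corner both `x₁` and `x₂` are nonzero, so `origin` agrees with `(x₁ , x₂ , zero)` but
      -- not with `(x₁ , x₂ , suc k)`.
      = contradiction (y⇒x (here refl) (inj₂ (inj₂ refl))) no-zero
    third-determined x₁ x₂ zero (suc l) x⇒y y⇒x
      = sym (third-determined x₁ x₂ (suc l) zero y⇒x x⇒y)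
    third-determined x₁ x₂ (suc k) (suc l) x⇒y y⇒x with k ≟ l
    ... | yes k≡l = cong suc k≡l
    ... | no  k≢l
      with ε , r , s ← corner D (λ ε → x⇒y (vertex∈designSet k ε)) (k≢l ∘ suc-injective)
      with η , t , u ← corner D (λ ε → y⇒x (vertex∈designSet l ε)) (k≢l ∘ sym ∘ suc-injective)
      -- `(x₁ , x₂)` is a corner of both pairs `k` and `l`.
      = cong suc (pair-inj true ε η (suc-injective (trans (sym r) t)) (suc-injective (trans (sym s) u)))

    x₃≡y₃ : x₃ ≡ y₃
    x₃≡y₃ = third-determined x₁ x₂ x₃ y₃
      (λ {w} w∈ → subst₂ (λ y₁ y₂ → Agree (y₁ , y₂ , y₃) w) (sym x₁≡y₁) (sym x₂≡y₂) ∘ x⇒y w∈)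
      (λ {w} w∈ → y⇒x w∈ ∘ subst₂ (λ y₁ y₂ → Agree (y₁ , y₂ , y₃) w) x₁≡y₁ x₂≡y₂)

  open Graph G using (Adj)

  adjacent? : ∀ x w → Dec (Adj x w)
  adjacent? (x₁ , x₂ , x₃) (w₁ , w₂ , w₃) = ¬? (x₁ ≟ w₁) ×-dec ¬? (x₂ ≟ w₂) ×-dec ¬? (x₃ ≟ w₃)

  agree⇒¬adjacent : ∀ x w → Agree x w → ¬ Adj x w
  agree⇒¬adjacent x w (inj₁ e)        (≢₁ , _ , _) = ≢₁ e
  agree⇒¬adjacent x w (inj₂ (inj₁ e)) (_ , ≢₂ , _) = ≢₂ e
  agree⇒¬adjacent x w (inj₂ (inj₂ e)) (_ , _ , ≢₃) = ≢₃ e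

  ¬adjacent⇒agree : ∀ x w → ¬ Adj x w → Agree x w
  ¬adjacent⇒agree (x₁ , x₂ , x₃) (w₁ , w₂ , w₃) ¬xw with x₁ ≟ w₁ | x₂ ≟ w₂ | x₃ ≟ w₃
  ... | yes e | _     | _     = inj₁ e
  ... | no _  | yes e | _     = inj₂ (inj₁ e)
  ... | no _  | no _  | yes e = inj₂ (inj₂ e)
  ... | no ≢₁ | no ≢₂ | no ≢₃ = contradiction (≢₁ , ≢₂ , ≢₃) ¬xw

  designSet-resolving : Resolving G designSet
  designSet-resolving x y _ _ x≢y with Any.any?
    (λ w → (adjacent? x w ×-dec ¬? (adjacent? y w)) ⊎-dec (¬? (adjacent? x w) ×-dec adjacent? y w)) designSet
  ... | yes some with w , w∈ , differs ← find some = w , w∈ , adjacency-separates G differs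
  ... | no none = contradiction (agreement-determines x y
        (λ {w} w∈ xw → ¬adjacent⇒agree y w (λ yw → none (lose w∈ (inj₂ (agree⇒¬adjacent x w xw , yw)))))
        (λ {w} w∈ yw → ¬adjacent⇒agree x w (λ xw → none (lose w∈ (inj₁ (xw , agree⇒¬adjacent y w yw))))))
      x≢y

  -- `origin` is adjacent to all vertices without zero coordinates; the others have a neighbour
  -- among the cells by `free-cell`.
  designSet-totalDominating : 2 ≤ a → 2 ≤ b → TotalDominating G designSet
  designSet-totalDominating 2≤a 2≤b (suc x₁ , suc x₂ , suc x₃) = origin , here refl , (λ ()) , (λ ()) , (λ ())
  designSet-totalDominating 2≤a 2≤b (zero , x₂ , x₃)
    with j , x₂≢j ← other-line 2≤b x₂
    -- Transposing moves the zero to the second coordinate, where `free-cell` expects it.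
    with k , ε , ≢₂ , ≢₁ , ≢₃ ← free-cell (transpose D) x₂ zero x₃ x₂≢j (inj₁ refl)
    = vertex D k ε , vertex∈designSet k ε , ≢₁ , ≢₂ , ≢₃
  designSet-totalDominating 2≤a 2≤b (x₁@(suc _) , zero , x₃)
    with i , x₁≢i ← other-line 2≤a x₁
    with k , ε , adj ← free-cell D x₁ zero x₃ x₁≢i (inj₁ refl)
    = vertex D k ε , vertex∈designSet k ε , adj
  designSet-totalDominating 2≤a 2≤b (x₁@(suc _) , x₂@(suc _) , zero)
    with i , x₁≢i ← other-line 2≤a x₁
    with k , ε , adj ← free-cell D x₁ x₂ zero x₁≢i (inj₂ refl)
    = vertex D k ε , vertex∈designSet k ε , adj

designs-exist : ∀ a b → 3 ≤ a → 3 ≤ b → Designs a b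
designs-exist a b 3≤a 3≤b with ≤-total b a
... | inj₁ b≤a = subst (λ m → Designs m b) (m∸n+n≡m b≤a) (designs (a ∸ b) b (<-wellFounded _) 3≤b)
... | inj₂ a≤b = transposeDesigns b a
  (subst (λ m → Designs m a) (m∸n+n≡m a≤b) (designs (b ∸ a) a (<-wellFounded _) 3≤a))

module _ {n₁ n₂ n₃} (3≤n₁ : 3 ≤ n₁) (3≤n₂ : 3 ≤ n₂) (n₁≤n₃ : n₁ ≤ n₃) (D : DesignFin n₁ n₂ n₃) where

  private
    G = K (suc n₁) ⊗ K (suc n₂) ⊗ K (suc n₃)

  design⇒minSize : ∀ {P : List (Vertex G) → Set} → P (designSet D) → (∀ V → P V → Resolving G V) →
    MinSize G P (suc (2 * n₃))
  design⇒minSize P-designSet P⇒resolving =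
    (designSet D , designSet-unique D , P-designSet , designSet-length D) , λ V _ → lower 3≤n₁ 3≤n₂ n₁≤n₃ V ∘ P⇒resolving V
    where
    -- Matching on the bounds exposes each `suc n` as `3 + _`, the form required by
    -- `resolving-size`.
    lower : ∀ {n₁ n₂ n₃} → 3 ≤ n₁ → 3 ≤ n₂ → n₁ ≤ n₃ → ∀ V →
      Resolving (K (suc n₁) ⊗ K (suc n₂) ⊗ K (suc n₃)) V → suc (2 * n₃) ≤ length V
    lower (s≤s (s≤s _)) (s≤s (s≤s _)) (s≤s (s≤s _)) = resolving-size

  design⇒minSizes : MetricDimension G (suc (2 * n₃))
    × LocationDominationNumber G (suc (2 * n₃))
    × LocationTotalDominationNumber G (suc (2 * n₃))
  design⇒minSizes =
      design⇒minSize (designSet-resolving D) (λ _ → id)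
    , design⇒minSize (designSet-resolving D , inj₂ ∘ dominating) (λ _ → proj₁)
    , design⇒minSize (designSet-resolving D , dominating) (λ _ → proj₁)
    where
    dominating : TotalDominating G (designSet D)
    dominating = designSet-totalDominating D (≤-trans (n≤1+n 2) 3≤n₁) (≤-trans (n≤1+n 2) 3≤n₂)

mainTheorem12 : (n₁ n₂ n₃ : ℕ) →
    3 ≤ n₁ → 3 ≤ n₂ → n₁ ≤ n₃ → n₂ ≤ n₃ →
    3 * (n₁ ⊔ n₂) ≤ 2 * n₃ → 2 * n₃ ≤ n₁ * n₂ →
    let G = K (n₁ + 1) ⊗ K (n₂ + 1) ⊗ K (n₃ + 1)
        k = 2 * (n₃ + 1) ∸ 1
    in MetricDimension G k
     × LocationDominationNumber G k
     × LocationTotalDominationNumber G k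
mainTheorem12 n₁ n₂ n₃ 3≤n₁ 3≤n₂ n₁≤n₃ _ 3max≤2n₃ 2n₃≤n₁n₂
  -- After the first three rewrites `k` computes to `n₃ + suc (n₃ + 0)`, which the last one turns
  -- into `suc (2 * n₃)`.
  rewrite +-comm n₁ 1 | +-comm n₂ 1 | +-comm n₃ 1 | +-suc n₃ (n₃ + 0) =
  design⇒minSizes 3≤n₁ 3≤n₂ n₁≤n₃ (designs-exist n₁ n₂ 3≤n₁ 3≤n₂ n₃
    (≤-trans (*-monoʳ-≤ 3 (m≤m⊔n n₁ n₂)) 3max≤2n₃)
    (≤-trans (*-monoʳ-≤ 3 (m≤n⊔m n₁ n₂)) 3max≤2n₃) 2n₃≤n₁n₂)
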